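{- Let $(\sigma,\pi)$ be a compatible pair and let $(s_n)_{n\in\omega}$, $s_n\in\mathcal S(n+1)$, be the sequence derived from $(\sigma,\pi)$. Then $(s_n)_n$ is realised in the class of uniform chains of rank $\omega$; that is, there are a uniform chain $A$ of rank $\omega$ and an element $x\in A$ such that $[x]_n\cong\mathcal A(s_n)$ for all $n\in\omega$.
   Context: A chain is a linearly ordered set; $\cong$ is order isomorphism. $A+B$ is the ordered sum, $AB=\sum_{b\in B}A$ the anti-lexicographic product; $1$ is the one-element chain. For a chain $A$ define equivalence relations $\rho_\alpha$: $\rho_0$ is equality; $A/\alpha$ is the quotient chain of classes $[x]_\alpha$ (the $\alpha$-components); $x\rho_{\alpha+1}y$ iff the interval between $[x]_\alpha$ and $[y]_\alpha$ in $A/\alpha$ is finite; for limit $\alpha$, $x\rho_\alpha y$ iff $x\rho_\beta y$ for some $\beta<\alpha$. $\mathrm{rk}(A)$ is the least $\alpha$ with $A/\alpha\cong1$. $A$ is uniform if $A^{\ge x}=\{y\in A:x\le y\}$ has the same order type for all $x\in A$. $\mathcal S(\alpha)$ is the set of sequences $s:\alpha\to\alpha$ with $s(i)\le i$ for all $i<\alpha$; $s\restriction k$ is restriction and $t^\frown a$ is $t$ with the entry $a$ appended. For $s\in\mathcal S(n+1)$, $n\ge1$: $s^-=s\restriction n$, and $s^+$ is $s$ with the next-to-last entry $s(n-1)$ deleted (in $\mathcal S(n)$ iff $s(n)<n$). Put $\mathcal A(\langle0\rangle)=1$, $\mathcal A(s)=\mathcal A(s^-)\mathbb Z$ if $s(n)=n$,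 and $\mathcal A(s)=\mathcal A(s^+)+\mathcal A(s^-)\mathbb N$ if $s(n)<n$. By Pastijn's theorem the chains $\mathcal A(s)$, $s\in\mathcal S(n+1)$, exhaust the uniform chains of rank $n$ up to isomorphism. Let $\sigma\in\mathcal S(\omega+1)$ and $\pi:\omega\to\omega+1$. For $n\in\omega$ let $w_n$ be the least $v$ with $n\le v<\omega$ and $\pi(v)>0$ if such $v$ exists, and $w_n=\omega$ otherwise. The pair $(\sigma,\pi)$ is compatible if (i) for all $k\in\omega$, $\sigma(k)=k$ iff $\pi(k)=\omega$; and (ii) for every $n\in\omega$ with $\pi(n)=0$, $\sigma(w_n)\le n$. The sequence derived from $(\sigma,\pi)$ is given by $s_n=\sigma\restriction(n+1)$ if $\pi(n)>0$, and $s_n=(\sigma\restriction n)^\frown\sigma(w_n)$ if $\pi(n)=0$. -}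

module Defs where

open import Level using (0ℓ)
open import Data.Nat.Base as ℕ using (ℕ; zero; suc)
import Data.Nat.Properties as ℕ
import Data.Integer.Properties as ℤ
open import Data.Fin.Base as Fin using (Fin; toℕ; fromℕ; fromℕ<; inject₁)
import Data.Fin.Properties as Fin
open import Data.Fin.Relation.Unary.Top using (view; ‵fromℕ; ‵inject₁)
open import Data.List.Base using (List; []; _∷_; _++_; map)
open import Data.List.Relation.Unary.Any as Any using (Any; here; there)
import Data.List.Relation.Unary.Any.Properties as Any
open import Data.List.Relation.Unary.Enumerates.Setoid using (IsEnumeration)
open import Data.Product using (Σ; ∃; _×_; _,_; proj₁; proj₂)
open import Data.Product.Relation.Binary.Lex.NonStrict using (×-totalOrder)
open import Data.Sum.Base using (_⊎_; inj₁; inj₂; swap)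
open import Data.Sum.Relation.Binary.LeftOrder using (⊎-<-totalOrder)
import Data.Unit.Properties as Unit
open import Function.Base using (_∘_)
open import Function.Bundles using (_⇔_)
open import Relation.Binary.Bundles using (Setoid; TotalOrder; DecTotalOrder)
open import Relation.Binary.Core using (Rel)
open import Relation.Binary.Structures using (IsEquivalence)
open import Relation.Binary.Morphism.Structures using (IsOrderIsomorphism)
import Relation.Binary.Construct.On as On
import Relation.Binary.Construct.Add.Supremum.NonStrict as NonStrict
import Relation.Binary.Construct.Add.Supremum.Strict as Strict
open import Relation.Nullary using (¬_; Dec; yes; no)
open import Relation.Nullary.Construct.Add.Supremum using (_⁺; [_]; ⊤⁺; ≡-dec)
open import Relation.Binary.PropositionalEquality as ≡ using (_≡_; subst)

------------------------------------------------------------------------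
-- Chains

-- The underlying equality is a setoid equality, so that a quotient chain
-- can keep the carrier of the original chain.
Chain : Set₁
Chain = TotalOrder 0ℓ 0ℓ 0ℓ

DecChain : Set₁
DecChain = DecTotalOrder 0ℓ 0ℓ 0ℓ

∣_∣ : Chain → Set
∣ A ∣ = TotalOrder.Carrier A

infix 4 _≅_
_≅_ : Chain → Chain → Set
A ≅ B = ∃ (IsOrderIsomorphism A._≈_ B._≈_ A._≤_ B._≤_)
  where module A = TotalOrder A
        module B = TotalOrder B

𝟏 : Chain
𝟏 = DecTotalOrder.totalOrder Unit.≡-decTotalOrder

infixl 6 _⊕_
_⊕_ : Chain → Chain → Chain
_⊕_ = ⊎-<-totalOrder

-- The product AB = Σ_{b ∈ B} A.  Elements are written (b , a), so the
-- lexicographic order on these pairs is the anti-lexicographic order on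
-- A × B.  Equality in B is decided in order to compare pairs.
infixl 7 _⊗_
_⊗_ : Chain → DecChain → Chain
A ⊗ B = ×-totalOrder B A

subchain : (A : Chain) → (∣ A ∣ → Set) → Chain
subchain A P = On.totalOrder A (proj₁ {B = P})

Uniform : Chain → Set
Uniform A = ∀ x y → subchain A (x ≤_) ≅ subchain A (y ≤_)
  where open TotalOrder A

------------------------------------------------------------------------
-- Quotients by convex equivalence relations

record ConvexEquivalence (A : Chain) : Set₁ where
  open TotalOrder A using (_≈_; _≤_)
  infix 4 _∼_
  field
    _∼_           : Rel ∣ A ∣ 0ℓ
    isEquivalence : IsEquivalence _∼_
    reflexive     : ∀ {x y} → x ≈ y → x ∼ y
    convex        : ∀ {x y z} → x ≤ y → y ≤ z → x ∼ z → x ∼ y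

  open IsEquivalence isEquivalence public
    using () renaming (refl to ∼-refl; sym to ∼-sym; trans to ∼-trans)

-- Convexity makes the classes [x] into a chain, in which [x] ≤ [y] iff
-- x ≤ y or [x] = [y].
infix 8 _/_
_/_ : (A : Chain) → ConvexEquivalence A → Chain
A / E = record
  { Carrier = ∣ A ∣
  ; _≈_ = _∼_
  ; _≤_ = λ x y → x ≤ y ⊎ x ∼ y
  ; isTotalOrder = record
    { isPartialOrder = record
      { isPreorder = record
        { isEquivalence = isEquivalence
        ; reflexive = inj₂
        ; trans = /-trans
        }
      ; antisym = /-antisym
      }
    ; total = /-total
    }
  }
  where
  open TotalOrder A using (_≤_; total; antisym) renaming (trans to ≤-trans)
  open ConvexEquivalence E

  /-trans : ∀ {x y z} → x ≤ y ⊎ x ∼ y → y ≤ z ⊎ y ∼ z → x ≤ z ⊎ x ∼ z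
  /-trans (inj₁ x≤y) (inj₁ y≤z) = inj₁ (≤-trans x≤y y≤z)
  /-trans {x} {y} {z} (inj₁ x≤y) (inj₂ y∼z) with total x z
  ... | inj₁ x≤z = inj₁ x≤z
  ... | inj₂ z≤x = inj₂ (∼-sym (convex z≤x x≤y (∼-sym y∼z)))
  /-trans {x} {y} {z} (inj₂ x∼y) (inj₁ y≤z) with total x z
  ... | inj₁ x≤z = inj₁ x≤z
  ... | inj₂ z≤x = inj₂ (∼-trans x∼y (convex y≤z z≤x (∼-sym x∼y)))
  /-trans (inj₂ x∼y) (inj₂ y∼z) = inj₂ (∼-trans x∼y y∼z)

  /-antisym : ∀ {x y} → x ≤ y ⊎ x ∼ y → y ≤ x ⊎ y ∼ x → x ∼ y
  /-antisym (inj₂ x∼y) _          = x∼y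
  /-antisym (inj₁ _)   (inj₂ y∼x) = ∼-sym y∼x
  /-antisym (inj₁ x≤y) (inj₁ y≤x) = reflexive (antisym x≤y y≤x)

  /-total : ∀ x y → (x ≤ y ⊎ x ∼ y) ⊎ (y ≤ x ⊎ y ∼ x)
  /-total x y with total x y
  ... | inj₁ x≤y = inj₁ (inj₁ x≤y)
  ... | inj₂ y≤x = inj₂ (inj₁ y≤x)

------------------------------------------------------------------------
-- Finite intervals

Finite : Setoid 0ℓ 0ℓ → Set
Finite S = ∃ (IsEnumeration S)

module _ (A : Chain) where
  open TotalOrder A

  Between : ∣ A ∣ → ∣ A ∣ → ∣ A ∣ → Set
  Between x y z = (x ≤ z × z ≤ y) ⊎ (y ≤ z × z ≤ x)

  Interval : ∣ A ∣ → ∣ A ∣ → Setoid 0ℓ 0ℓ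
  Interval x y = On.setoid Eq.setoid (proj₁ {B = Between x y})

  FiniteInterval : Rel ∣ A ∣ 0ℓ
  FiniteInterval x y = Finite (Interval x y)

  -- Enumerations of an interval may list only its members; clamping lets
  -- a list of arbitrary elements of A that covers the interval be used.
  clamp′ : ∀ {x y} → x ≤ y → ∀ e →
           Σ (Σ ∣ A ∣ λ z → x ≤ z × z ≤ y)
             (λ z → ∀ {w} → x ≤ w × w ≤ y → w ≈ e → w ≈ proj₁ z)
  clamp′ {x} {y} x≤y e with total e x | total y e
  ... | inj₁ e≤x | _ = (x , refl , x≤y) ,
    λ (x≤w , _) w≈e → antisym (≤-respˡ-≈ (Eq.sym w≈e) e≤x) x≤w
  ... | inj₂ x≤e | inj₁ y≤e = (y , x≤y , refl) ,
    λ (_ , w≤y) w≈e → antisym w≤y (≤-respʳ-≈ (Eq.sym w≈e) y≤e)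
  ... | inj₂ x≤e | inj₂ e≤y = (e , x≤e , e≤y) , λ _ w≈e → w≈e

  clamp : ∀ x y e → Σ (Σ ∣ A ∣ (Between x y))
          (λ z → ∀ {w} → Between x y w → w ≈ e → w ≈ proj₁ z)
  clamp x y e with total x y
  ... | inj₁ x≤y with clamp′ x≤y e
  ...   | (z , b) , p = (z , inj₁ b) , λ where
    (inj₁ c) w≈e → p c w≈e
    (inj₂ (y≤w , w≤x)) w≈e →
      p (trans x≤y y≤w , trans w≤x x≤y) w≈e
  clamp x y e | inj₂ y≤x with clamp′ y≤x e
  ...   | (z , b) , p = (z , inj₂ b) , λ where
    (inj₂ c) w≈e → p c w≈e
    (inj₁ (x≤w , w≤y)) w≈e →
      p (trans y≤x x≤w , trans w≤y y≤x) w≈e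

  fromCover : ∀ {x y} (es : List ∣ A ∣) →
              (∀ {w} → Between x y w → Any (w ≈_) es) → FiniteInterval x y
  fromCover {x} {y} es cover =
    map (λ e → proj₁ (clamp x y e)) es ,
    λ (w , b) → Any.map⁺ (Any.map (λ {e} → proj₂ (clamp x y e) b) (cover b))

  toCover : ∀ {x y} ((es , _) : FiniteInterval x y) →
            ∀ {w} → Between x y w → Any (w ≈_) (map proj₁ es)
  toCover (es , enum) b = Any.map⁺ (enum (_ , b))

  finiteInterval : ConvexEquivalence A
  finiteInterval = record
    { _∼_ = FiniteInterval
    ; isEquivalence = record
      { refl = fi-reflexive Eq.refl
      ; sym = λ F → fromCover _ (λ b → toCover F (swap b))
      ; trans = fi-trans
      }
    ; reflexive = fi-reflexive
    ; convex = λ x≤y y≤z F → fromCover _ λ where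
        (inj₁ (x≤w , w≤y)) → toCover F (inj₁ (x≤w , trans w≤y y≤z))
        (inj₂ (y≤w , w≤x)) →
          toCover F (inj₁ (trans x≤y y≤w , trans w≤x (trans x≤y y≤z)))
    }
    where
    fi-reflexive : ∀ {x y} → x ≈ y → FiniteInterval x y
    fi-reflexive {x} x≈y = fromCover (x ∷ []) λ where
      (inj₁ (x≤w , w≤y)) → here (antisym (≤-respʳ-≈ (Eq.sym x≈y) w≤y) x≤w)
      (inj₂ (y≤w , w≤x)) → here (antisym w≤x (≤-respˡ-≈ (Eq.sym x≈y) y≤w))

    fi-trans : ∀ {x y z} →
               FiniteInterval x y → FiniteInterval y z → FiniteInterval x z
    fi-trans {x} {y} {z} F G =
      fromCover (map proj₁ (proj₁ F) ++ map proj₁ (proj₁ G)) (λ {w} → cover w)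
      where
      left : ∀ {w} → Between x y w → Any (w ≈_) _
      left b = Any.++⁺ˡ (toCover F b)
      right : ∀ {w} → Between y z w → Any (w ≈_) _
      right b = Any.++⁺ʳ (map proj₁ (proj₁ F)) (toCover G b)
      cover : ∀ w → Between x z w → Any (w ≈_) _
      cover w b with total w y | b
      ... | inj₁ w≤y | inj₁ (x≤w , _) = left (inj₁ (x≤w , w≤y))
      ... | inj₁ w≤y | inj₂ (z≤w , _) = right (inj₂ (z≤w , w≤y))
      ... | inj₂ y≤w | inj₁ (_ , w≤z) = right (inj₁ (y≤w , w≤z))
      ... | inj₂ y≤w | inj₂ (_ , w≤x) = left (inj₂ (y≤w , w≤x))

------------------------------------------------------------------------
-- The ordinals up to ω, with ⊤⁺ for ω

ω+1 : Set
ω+1 = ℕ ⁺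

open NonStrict ℕ._≤_ using (_≤⁺_; [_])
open Strict ℕ._<_ using (_<⁺_)

_≟⁺_ : (a b : ω+1) → Dec (a ≡ b)
_≟⁺_ = ≡-dec ℕ._≟_

------------------------------------------------------------------------
-- The relations ρ_α for α ≤ ω, and rank
--
-- rk(A) = α only involves ρ_β for β ≤ α, so these suffice to define
-- rk(A) = α for each α ≤ ω.

module _ (A : Chain) where

  ρ< : ℕ → ConvexEquivalence A
  ρ< zero = record
    { _∼_ = _≈_
    ; isEquivalence = isEquivalence
    ; reflexive = λ x≈y → x≈y
    ; convex = λ x≤y y≤z x≈z → antisym x≤y (≤-respʳ-≈ (Eq.sym x≈z) y≤z)
    }
    where open TotalOrder A
  ρ< (suc n) = record
    { _∼_ = F._∼_
    ; isEquivalence = F.isEquivalence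
    ; reflexive = λ x≈y → F.reflexive (ConvexEquivalence.reflexive (ρ< n) x≈y)
    ; convex = λ x≤y y≤z → F.convex (inj₁ x≤y) (inj₁ y≤z)
    }
    where module F = ConvexEquivalence (finiteInterval (A / ρ< n))

  module ρ< (n : ℕ) = ConvexEquivalence (ρ< n)

  ρ<-mono : ∀ {m n x y} → m ℕ.≤′ n → ρ<._∼_ m x y → ρ<._∼_ n x y
  ρ<-mono (ℕ.≤′-reflexive ≡.refl) r = r
  ρ<-mono (ℕ.≤′-step {n} m≤n) r =
    ConvexEquivalence.reflexive (finiteInterval (A / ρ< n)) (ρ<-mono m≤n r)

  ρ : ω+1 → ConvexEquivalence A
  ρ [ n ] = ρ< n
  ρ ⊤⁺    = record
    { _∼_ = λ x y → ∃ λ n → ρ<._∼_ n x y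
    ; isEquivalence = record
      { refl = 0 , ρ<.∼-refl 0
      ; sym = λ (n , r) → n , ρ<.∼-sym n r
      ; trans = λ (m , r) (n , s) → m ℕ.⊔ n ,
          ρ<.∼-trans (m ℕ.⊔ n) (ρ<-mono (ℕ.≤⇒≤′ (ℕ.m≤m⊔n m n)) r)
                               (ρ<-mono (ℕ.≤⇒≤′ (ℕ.m≤n⊔m m n)) s)
      }
    ; reflexive = λ x≈y → 0 , x≈y
    ; convex = λ x≤y y≤z (n , r) → n , ρ<.convex n x≤y y≤z r
    }

  IsRank : ω+1 → Set
  IsRank α = A / ρ α ≅ 𝟏 × (∀ β → β <⁺ α → ¬ (A / ρ β ≅ 𝟏))

  component : ω+1 → ∣ A ∣ → Chain
  component α x = subchain A (ConvexEquivalence._∼_ (ρ α) x)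

------------------------------------------------------------------------
-- The sequences 𝒮(α)

record 𝒮 (α : Chain) : Set where
  open TotalOrder α
  field
    at   : Carrier → Carrier
    at-≤ : ∀ i → at i ≤ i

open 𝒮 public

𝒮ω+1 : Set
𝒮ω+1 = 𝒮 (record { isTotalOrder = NonStrict.≤⁺-isTotalOrder-≡ _ ℕ.≤-isTotalOrder })

𝒮< : ℕ → Set
𝒮< n = 𝒮 (Fin.≤-totalOrder n)

fromValues : ∀ {n} (f : Fin n → ℕ) → (∀ i → f i ℕ.≤ toℕ i) → 𝒮< n
fromValues f f≤ .at i = fromℕ< (ℕ.≤-<-trans (f≤ i) (Fin.toℕ<n i))
fromValues f f≤ .at-≤ i =
  subst (ℕ._≤ toℕ i) (≡.sym (Fin.toℕ-fromℕ< _)) (f≤ i)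

append : ∀ {n} → 𝒮< n → (a : ℕ) → a ℕ.≤ n → 𝒮< (suc n)
append {n} t a a≤n = fromValues value value-≤
  where
  value : Fin (suc n) → ℕ
  value i with view i
  ... | ‵fromℕ     = a
  ... | ‵inject₁ j = toℕ (at t j)
  value-≤ : ∀ i → value i ℕ.≤ toℕ i
  value-≤ i with view i
  ... | ‵fromℕ     = subst (a ℕ.≤_) (≡.sym (Fin.toℕ-fromℕ n)) a≤n
  ... | ‵inject₁ j = ℕ.≤-trans (at-≤ t j) (ℕ.≤-reflexive (≡.sym (Fin.toℕ-inject₁ j)))

infix 9 _⁻
_⁻ : ∀ {n} → 𝒮< (suc n) → 𝒮< n
s ⁻ = fromValues (λ i → toℕ (at s (inject₁ i)))
  (λ i → ℕ.≤-trans (at-≤ s (inject₁ i)) (ℕ.≤-reflexive (Fin.toℕ-inject₁ i)))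

last : ∀ {n} → 𝒮< (suc n) → ℕ
last {n} s = toℕ (at s (fromℕ n))

last-≤ : ∀ {n} (s : 𝒮< (suc n)) → last s ℕ.≤ n
last-≤ {n} s = ℕ.≤-trans (at-≤ s (fromℕ n)) (ℕ.≤-reflexive (Fin.toℕ-fromℕ n))

-- Deleting the next-to-last entry amounts to removing the last two
-- entries and putting the last one back.
plus : ∀ {n} (s : 𝒮< (suc (suc n))) → last s ℕ.< suc n → 𝒮< (suc n)
plus s l<1+n = append (s ⁻ ⁻) (last s) (ℕ.≤-pred l<1+n)

𝒜 : ∀ n → 𝒮< (suc n) → Chain
𝒜 zero    s = 𝟏
𝒜 (suc n) s with last s ℕ.≟ suc n
... | yes _   = 𝒜 n (s ⁻) ⊗ ℤ.≤-decTotalOrder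
... | no l≢1+n =
  𝒜 n (plus s (ℕ.≤∧≢⇒< (last-≤ s) l≢1+n)) ⊕ 𝒜 n (s ⁻) ⊗ ℕ.≤-decTotalOrder

finiteValue : ∀ {a n} → a ≤⁺ [ n ] → ℕ
finiteValue ([_] {m} _) = m

finiteValue-≤ : ∀ {a n} (a≤n : a ≤⁺ [ n ]) → finiteValue a≤n ℕ.≤ n
finiteValue-≤ [ m≤n ] = m≤n

infix 8 _↾_
_↾_ : 𝒮ω+1 → (k : ℕ) → 𝒮< k
σ ↾ k = fromValues (λ i → finiteValue (at-≤ σ [ toℕ i ]))
                   (λ i → finiteValue-≤ (at-≤ σ [ toℕ i ]))

------------------------------------------------------------------------
-- Compatible pairs and derived sequences

-- NextPositive π n v says that v = w_n.  Classically there is exactly one such v,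
-- but computing it from π and n requires deciding whether π vanishes on
-- [n , ω), so below w is given together with the proof that it is
-- n ↦ w_n.
data NextPositive (π : ℕ → ω+1) (n : ℕ) : ω+1 → Set where
  least : ∀ {v} → n ℕ.≤ v → [ 0 ] <⁺ π v →
          (∀ {u} → n ℕ.≤ u → [ 0 ] <⁺ π u → v ℕ.≤ u) →
          NextPositive π n [ v ]
  none  : (∀ {v} → n ℕ.≤ v → ¬ ([ 0 ] <⁺ π v)) → NextPositive π n ⊤⁺

record Compatible (σ : 𝒮ω+1) (π w : ℕ → ω+1) : Set where
  field
    fixed⇔ω : ∀ k → at σ [ k ] ≡ [ k ] ⇔ π k ≡ ⊤⁺
    next-≤  : ∀ n → π n ≡ [ 0 ] → at σ (w n) ≤⁺ [ n ]

derived : (σ : 𝒮ω+1) (π w : ℕ → ω+1) → Compatible σ π w → ∀ n → 𝒮< (suc n)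
derived σ π w c n with π n ≟⁺ [ 0 ]
... | yes πn≡0 = append (σ ↾ n) (finiteValue σw≤n) (finiteValue-≤ σw≤n)
  where σw≤n = Compatible.next-≤ c n πn≡0
... | no _     = σ ↾ suc n

module Submission where

-- A point of a chain of rank ω that is built up from Pastijn's chains is
-- described by its coordinates: for each k, the position (an integer) of its
-- k-component among the k-components of its (k+1)-component, and the last
-- entry of the sequence s such that the k-component is 𝒜 k s; the other
-- entries of s are those of σ.  The recursion defining 𝒜 says which positions
-- and last entries can follow each other (Step), so that 𝒜 n s becomes the
-- anti-lexicographically ordered set of all coherent coordinate sequences
-- below n with last entry of s on top (coding-𝒜).
--
-- Compatibility of (σ , π) makes the last entries of the derived sequences
-- the states of a coherent code (derived-step): where π n > 0 the last entry
-- of s_n is σ n, as for a component that is not the first one, and where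
-- π n = 0 it is passed on unchanged from s_(n+1).  The chain A consists of
-- all coherent codes that agree with this one from some entry on.
--
-- A is uniform because the components at positions above the k-component of
-- a point, in the same (k+1)-component, all have last entry σ k, whatever the
-- point is (step-raise).  So a point z > x can be moved above any y: at the
-- last difference of z and x, add this difference to the coordinate of y, and
-- below it copy the coordinates of z (translate).
--
-- The relation ρ_n is agreement from the n-th entry on (ρ⇔agree): raising the
-- n-th coordinate by one steps through the n-components of an
-- (n+1)-component, which is discrete without last element, and
-- FiniteIntervals.finite⇔∼ applies.  Hence A has rank ω, and the n-component
-- of the distinguished point is coded just like 𝒜 n s_n (component-≅).

open import Defs
open import Data.Nat.Base using (ℕ)
open import Data.Product using (Σ; _×_)
open import Relation.Nullary.Construct.Add.Supremum using ([_]; ⊤⁺)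

open import Data.Nat.Base as ℕ using (zero; suc)
open import Algebra.Bundles using (module AbelianGroup)
import Algebra.Properties.Group as Group
import Data.Nat.Properties as ℕ
open import Data.Nat.GeneralisedArithmetic using (iterate)
open import Data.Integer.Base as ℤ using (ℤ; +_; -[1+_]; 0ℤ; 1ℤ)
import Data.Integer.Properties as ℤ
open import Data.Fin.Base as Fin using (Fin; toℕ; fromℕ; inject₁)
import Data.Fin.Properties as Fin
open import Data.Fin.Relation.Unary.Top using (view-fromℕ; view-inject₁)
open import Data.List.Base using (length; lookup; applyUpTo)
open import Data.List.Relation.Unary.Any as Any using (Any)
open import Data.List.Relation.Unary.Any.Properties using (applyUpTo⁺; lookup-index)
open import Data.Product using (∃; _,_; proj₁; proj₂)
open import Data.Sum.Base using (_⊎_; inj₁; inj₂)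
open import Data.Sum.Relation.Binary.LeftOrder using (₁∼₂; ₁∼₁; ₂∼₂)
open import Data.Unit.Base using (⊤; tt)
open import Function.Base using (_∘_; id)
open import Function.Bundles using (_⇔_; mk⇔; module Equivalence)
open import Relation.Binary.Bundles using (TotalOrder)
import Relation.Binary.Construct.Add.Supremum.NonStrict as NonStrict
import Relation.Binary.Construct.Add.Supremum.Strict as Strict
open import Relation.Binary.Morphism.Structures using (module IsOrderIsomorphism)
open import Relation.Binary.Definitions using (tri<; tri≈; tri>)
open import Relation.Binary.PropositionalEquality
  using (_≡_; _≢_; refl; sym; trans; cong; cong₂; subst; subst₂)
open import Relation.Nullary.Construct.Add.Supremum using ([]-injective)
open import Relation.Nullary using (¬_; Dec; yes; no; contradiction)
open Group (AbelianGroup.group ℤ.+-0-abelianGroup) using () renaming (∙-cancelˡ to +-cancelˡ)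
open NonStrict ℕ._≤_ using (_≤⁺_; [_])
open Strict ℕ._<_ using (_<⁺_; [_]; [_]<⊤⁺)

-- Order isomorphisms from correspondences

-- A total and surjective relation between chains that preserves and
-- reflects the order is single-valued and injective up to equality, so it
-- gives an isomorphism.
correspondence⇒≅ : (A B : Chain) (R : ∣ A ∣ → ∣ B ∣ → Set) →
                   (∀ a → ∃ λ b → R a b) → (∀ b → ∃ λ a → R a b) →
                   (∀ {a b a′ b′} → R a b → R a′ b′ →
                    TotalOrder._≤_ A a a′ → TotalOrder._≤_ B b b′) →
                   (∀ {a b a′ b′} → R a b → R a′ b′ →
                    TotalOrder._≤_ B b b′ → TotalOrder._≤_ A a a′) →
                   A ≅ B
correspondence⇒≅ A B R total surjective preserves reflects = f , record
  { isOrderMonomorphism = record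
    { isOrderHomomorphism = record
      { cong = λ a≈a′ → B.antisym (mono (A.reflexive a≈a′))
                                  (mono (A.reflexive (A.Eq.sym a≈a′)))
      ; mono = mono
      }
    ; injective = λ fa≈fa′ → A.antisym (cancel (B.reflexive fa≈fa′))
                                       (cancel (B.reflexive (B.Eq.sym fa≈fa′)))
    ; cancel = cancel
    }
  ; surjective = λ b → let a , Rab = surjective b in
      a , λ z≈a → B.antisym (preserves (R-f _) Rab (A.reflexive z≈a))
                            (preserves Rab (R-f _) (A.reflexive (A.Eq.sym z≈a)))
  }
  where
  module A = TotalOrder A
  module B = TotalOrder B
  f : ∣ A ∣ → ∣ B ∣
  f a = proj₁ (total a)
  R-f : ∀ a → R a (f a)
  R-f a = proj₂ (total a)
  mono : ∀ {a a′} → a A.≤ a′ → f a B.≤ f a′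
  mono = preserves (R-f _) (R-f _)
  cancel : ∀ {a a′} → f a B.≤ f a′ → a A.≤ a′
  cancel = reflects (R-f _) (R-f _)

-- Recognising finite intervals

-- The equivalence that F ⊇ E induces on the quotient by E.
coarsen : ∀ {A} (E F : ConvexEquivalence A) →
          (∀ {x y} → ConvexEquivalence._∼_ E x y → ConvexEquivalence._∼_ F x y) →
          ConvexEquivalence (A / E)
coarsen E F E⊆F = record
  { _∼_ = F._∼_
  ; isEquivalence = F.isEquivalence
  ; reflexive = E⊆F
  ; convex = λ where
      (inj₁ x≤y)  (inj₁ y≤z)  x∼z → F.convex x≤y y≤z x∼z
      (inj₁ _)    (inj₂ yEz)  x∼z → F.∼-trans x∼z (F.∼-sym (E⊆F yEz))
      (inj₂ xEy)  _           _   → E⊆F xEy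
  }
  where module F = ConvexEquivalence F

-- If every element x of a chain has a proper upper bound next x in its
-- F-class, and the iterates of next reach everything above x in that class,
-- then every F-class is discrete without last element; so F relates exactly
-- the pairs that bound a finite interval.
module FiniteIntervals
  (B : Chain) (F : ConvexEquivalence B) (next : ∣ B ∣ → ∣ B ∣)
  (≤-next : ∀ x → TotalOrder._≤_ B x (next x))
  (≉-next : ∀ x → ¬ TotalOrder._≈_ B x (next x))
  (∼-next : ∀ x → ConvexEquivalence._∼_ F x (next x))
  (reach : ∀ {x y} → TotalOrder._≤_ B x y → ConvexEquivalence._∼_ F x y →
           ∃ λ k → TotalOrder._≈_ B (iterate next x k) y)
  where

  open TotalOrder B
    using (_≈_; _≤_; antisym; total; ≤-respʳ-≈; module Eq)
    renaming (refl to ≤-refl; trans to ≤-trans)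
  open ConvexEquivalence F using (_∼_; ∼-refl; ∼-sym; ∼-trans; convex)
  open ConvexEquivalence (finiteInterval B)
    using () renaming (∼-sym to FiniteInterval-sym)

  iterate-mono : ∀ x {i j} → i ℕ.≤ j → iterate next x i ≤ iterate next x j
  iterate-mono x {zero} {zero}  _             = ≤-refl
  iterate-mono x {zero} {suc j} _             =
    ≤-trans (≤-next x) (iterate-mono (next x) (ℕ.z≤n {j}))
  iterate-mono x {suc i} {suc j} (ℕ.s≤s i≤j)  = iterate-mono (next x) i≤j

  iterate-∼ : ∀ x i → x ∼ iterate next x i
  iterate-∼ x zero    = ∼-refl
  iterate-∼ x (suc i) = ∼-trans (∼-next x) (iterate-∼ (next x) i)

  iterate-injective : ∀ x {i j} → i ℕ.< j → ¬ (iterate next x i ≈ iterate next x j)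
  iterate-injective x {zero}  {suc j} _ x≈ = ≉-next x (antisym (≤-next x)
    (≤-respʳ-≈ (Eq.sym x≈) (iterate-mono (next x) (ℕ.z≤n {j}))))
  iterate-injective x {suc i} {suc j} (ℕ.s≤s i<j) = iterate-injective (next x) i<j

  private
    ≤∧∼⇒finite : ∀ {x y} → x ≤ y → x ∼ y → FiniteInterval B x y
    ≤∧∼⇒finite {x} {y} x≤y x∼y =
      fromCover B (applyUpTo (iterate next x) (suc k)) λ where
        (inj₁ (x≤w , w≤y)) → cover x≤w w≤y
        (inj₂ (y≤w , w≤x)) → cover (≤-trans x≤y y≤w) (≤-trans w≤x x≤y)
      where
      k = proj₁ (reach x≤y x∼y)
      xₖ≈y = proj₂ (reach x≤y x∼y)
      cover : ∀ {w} → x ≤ w → w ≤ y →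
              Any (w ≈_) (applyUpTo (iterate next x) (suc k))
      cover x≤w w≤y with reach x≤w (convex x≤w w≤y x∼y)
      ... | j , xⱼ≈w with ℕ.≤-total j k
      ...   | inj₁ j≤k = applyUpTo⁺ (iterate next x) (Eq.sym xⱼ≈w) (ℕ.s≤s j≤k)
      ...   | inj₂ k≤j = applyUpTo⁺ (iterate next x)
        (antisym (≤-respʳ-≈ (Eq.sym xₖ≈y) w≤y)
                 (≤-respʳ-≈ xⱼ≈w (iterate-mono x k≤j)))
        (ℕ.≤-refl {suc k})

    ≤∧finite⇒∼ : ∀ {x y} → x ≤ y → FiniteInterval B x y → x ∼ y
    ≤∧finite⇒∼ {x} {y} x≤y finite with total y (iterate next x L)
      where L = length (proj₁ finite)
    ... | inj₁ y≤xL = convex x≤y y≤xL (iterate-∼ x (length (proj₁ finite)))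
    -- Otherwise the L + 1 distinct iterates of next up to the L-th all lie in
    -- the interval, which is enumerated by L elements.
    ... | inj₂ xL≤y = contradiction xᵢ≈xⱼ (iterate-injective x i<j)
      where
      es = proj₁ finite
      xᵢ∈ : ∀ (i : Fin (suc (length es))) →
            Any (λ e → iterate next x (toℕ i) ≈ proj₁ e) es
      xᵢ∈ i = proj₂ finite (iterate next x (toℕ i) , inj₁
        ( iterate-mono x {j = toℕ i} ℕ.z≤n
        , ≤-trans (iterate-mono x (Fin.toℕ≤pred[n] i)) xL≤y ))
      collision = Fin.pigeonhole (ℕ.n<1+n (length es)) (Any.index ∘ xᵢ∈)
      i = proj₁ collision
      j = proj₁ (proj₂ collision)
      i<j = proj₁ (proj₂ (proj₂ collision))
      xᵢ≈xⱼ : iterate next x (toℕ i) ≈ iterate next x (toℕ j)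
      xᵢ≈xⱼ = Eq.trans (lookup-index (xᵢ∈ i)) (Eq.sym
        (subst (λ l → iterate next x (toℕ j) ≈ proj₁ (lookup es l))
               (sym (proj₂ (proj₂ (proj₂ collision)))) (lookup-index (xᵢ∈ j))))

  finite⇔∼ : ∀ x y → FiniteInterval B x y ⇔ x ∼ y
  finite⇔∼ x y with total x y
  ... | inj₁ x≤y = mk⇔ (≤∧finite⇒∼ x≤y) (≤∧∼⇒finite x≤y)
  ... | inj₂ y≤x = mk⇔
    (λ fin → ∼-sym (≤∧finite⇒∼ y≤x (FiniteInterval-sym fin)))
    (λ x∼y → FiniteInterval-sym (≤∧∼⇒finite y≤x (∼-sym x∼y)))

-- Integer differences

i<j⇒0<j-i : ∀ {i j} → i ℤ.< j → 0ℤ ℤ.< j ℤ.- i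
i<j⇒0<j-i {i} {j} i<j =
  subst (ℤ._< j ℤ.- i) (ℤ.+-inverseʳ i) (ℤ.+-monoˡ-< (ℤ.- i) i<j)

0<d⇒i<i+d : ∀ i {d} → 0ℤ ℤ.< d → i ℤ.< i ℤ.+ d
0<d⇒i<i+d i {d} 0<d = subst (ℤ._< i ℤ.+ d) (ℤ.+-identityʳ i) (ℤ.+-monoʳ-< i 0<d)

+-cancelˡ-< : ∀ i {j k} → i ℤ.+ j ℤ.< i ℤ.+ k → j ℤ.< k
+-cancelˡ-< i i+j<i+k = ℤ.≰⇒> λ k≤j → ℤ.<⇒≱ i+j<i+k (ℤ.+-monoʳ-≤ i k≤j)

i+[j-i]≡j : ∀ i j → i ℤ.+ (j ℤ.- i) ≡ j
i+[j-i]≡j i j = trans (ℤ.+-comm i (j ℤ.- i))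
  (trans (ℤ.+-assoc j (ℤ.- i) i)
         (trans (cong (λ z → j ℤ.+ z) (ℤ.+-inverseˡ i)) (ℤ.+-identityʳ j)))

i≤j⇒i+n≡j : ∀ {i j} → i ℤ.≤ j → ∃ λ n → i ℤ.+ + n ≡ j
i≤j⇒i+n≡j {i} {j} i≤j = ℤ.∣ j ℤ.- i ∣ ,
  trans (cong (λ z → i ℤ.+ z) (ℤ.0≤i⇒+∣i∣≡i (ℤ.i≤j⇒0≤j-i i≤j))) (i+[j-i]≡j i j)

-- Codes and their anti-lexicographic order

-- The k-th entry (t , y) of a code says that the k-component of the coded
-- point is 𝒜 k s, where s has last entry t, and that it sits at position y in
-- its (k+1)-component.
Code : Set
Code = ℕ → ℕ × ℤ

state : ℕ × ℤ → ℕ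
state = proj₁

digit : ℕ × ℤ → ℤ
digit = proj₂

-- u and v agree from the n-th entry on.
Agree : ℕ → Code → Code → Set
Agree n u v = ∀ k → n ℕ.≤ k → u k ≡ v k

agree-refl : ∀ {n u} → Agree n u u
agree-refl _ _ = refl

agree-sym : ∀ {n u v} → Agree n u v → Agree n v u
agree-sym u~v k n≤k = sym (u~v k n≤k)

agree-trans : ∀ {n u v w} → Agree n u v → Agree n v w → Agree n u w
agree-trans u~v v~w k n≤k = trans (u~v k n≤k) (v~w k n≤k)

agree-weaken : ∀ {m n u v} → m ℕ.≤ n → Agree m u v → Agree n u v
agree-weaken m≤n u~v k n≤k = u~v k (ℕ.≤-trans m≤n n≤k)

agree-extend : ∀ {n u v} → u n ≡ v n → Agree (suc n) u v → Agree n u v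
agree-extend {u = u} {v} uₙ≡vₙ u~v k n≤k with ℕ.m≤n⇒m<n∨m≡n n≤k
... | inj₁ n<k  = u~v k n<k
... | inj₂ refl = uₙ≡vₙ

-- The last difference of u and v is at k, and u is the smaller one there.
_≺[_]_ : Code → ℕ → Code → Set
u ≺[ k ] v = digit (u k) ℤ.< digit (v k) × Agree (suc k) u v

infix 4 _≼_
_≼_ : Code → Code → Set
u ≼ v = Agree 0 u v ⊎ ∃ λ k → u ≺[ k ] v

≺-irrefl : ∀ {u v n k} → Agree n u v → n ℕ.≤ k → ¬ (u ≺[ k ] v)
≺-irrefl u~v n≤k (uₖ<vₖ , _) = ℤ.<-irrefl (cong digit (u~v _ n≤k)) uₖ<vₖ

≺-respˡ : ∀ {u v w k} → Agree k u v → v ≺[ k ] w → u ≺[ k ] w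
≺-respˡ {w = w} {k} u~v (vₖ<wₖ , v~w) =
  subst (λ e → digit e ℤ.< digit (w k)) (sym (u~v _ ℕ.≤-refl)) vₖ<wₖ ,
  agree-trans (agree-weaken (ℕ.n≤1+n _) u~v) v~w

≺-respʳ : ∀ {u v w k} → u ≺[ k ] v → Agree k v w → u ≺[ k ] w
≺-respʳ {u} {k = k} (uₖ<vₖ , u~v) v~w =
  subst (λ e → digit (u k) ℤ.< digit e) (v~w _ ℕ.≤-refl) uₖ<vₖ ,
  agree-trans u~v (agree-weaken (ℕ.n≤1+n _) v~w)

≺-trans : ∀ {u v w i j} → u ≺[ i ] v → v ≺[ j ] w →
          ∃ λ k → i ℕ.≤ k × u ≺[ k ] w
≺-trans {i = i} {j} u≺v@(uᵢ<vᵢ , u~v) v≺w@(vⱼ<wⱼ , v~w) with ℕ.<-cmp i j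
... | tri< i<j _ _  = j , ℕ.<⇒≤ i<j , ≺-respˡ (agree-weaken i<j u~v) v≺w
... | tri≈ _ refl _ = i , ℕ.≤-refl , ℤ.<-trans uᵢ<vᵢ vⱼ<wⱼ , agree-trans u~v v~w
... | tri> _ _ j<i  = i , ℕ.≤-refl , ≺-respʳ u≺v (agree-weaken j<i v~w)

≼-trans : ∀ {u v w} → u ≼ v → v ≼ w → u ≼ w
≼-trans (inj₁ u~v) (inj₁ v~w) = inj₁ (agree-trans u~v v~w)
≼-trans (inj₁ u~v) (inj₂ (k , v≺w)) = inj₂ (k , ≺-respˡ (agree-weaken ℕ.z≤n u~v) v≺w)
≼-trans (inj₂ (k , u≺v)) (inj₁ v~w) = inj₂ (k , ≺-respʳ u≺v (agree-weaken ℕ.z≤n v~w))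
≼-trans (inj₂ (_ , u≺v)) (inj₂ (_ , v≺w)) =
  let k , _ , u≺w = ≺-trans u≺v v≺w in inj₂ (k , u≺w)

agree-convex : ∀ {n u v w} → u ≼ v → v ≼ w → Agree n u w → Agree n u v
agree-convex (inj₁ u~v) _ _ = agree-weaken ℕ.z≤n u~v
agree-convex (inj₂ (k , u≺v)) (inj₁ v~w) u~w =
  agree-trans u~w (agree-sym (agree-weaken ℕ.z≤n v~w))
agree-convex {n} (inj₂ (i , u≺v)) (inj₂ (_ , v≺w)) u~w with n ℕ.≤? i
... | no n≰i  = agree-weaken (ℕ.≰⇒> n≰i) (proj₂ u≺v)
... | yes n≤i =
  let k , i≤k , u≺w = ≺-trans u≺v v≺w
  in contradiction u≺w (≺-irrefl u~w (ℕ.≤-trans n≤i i≤k))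

≼-antisym : ∀ {u v} → u ≼ v → v ≼ u → Agree 0 u v
≼-antisym u≼v v≼u = agree-convex u≼v v≼u agree-refl

≼⇒digit-≤ : ∀ {u v n} → u ≼ v → Agree (suc n) u v → digit (u n) ℤ.≤ digit (v n)
≼⇒digit-≤ {n = n} (inj₁ u~v) _ = ℤ.≤-reflexive (cong digit (u~v n ℕ.z≤n))
≼⇒digit-≤ {n = n} (inj₂ (k , u≺v@(uₖ<vₖ , u~v))) u~v′ with ℕ.<-cmp n k
... | tri< n<k _ _  = contradiction u≺v (≺-irrefl u~v′ n<k)
... | tri≈ _ refl _ = ℤ.<⇒≤ uₖ<vₖ
... | tri> _ _ k<n  = ℤ.≤-reflexive (cong digit (u~v n k<n))

-- Codes with prescribed entries

-- u with its n-th entry replaced by e.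
update : Code → ℕ → ℕ × ℤ → Code
update u n e k with k ℕ.≟ n
... | yes _ = e
... | no _  = u k

update-at : ∀ u n e → update u n e n ≡ e
update-at u n e with n ℕ.≟ n
... | yes _  = refl
... | no n≢n = contradiction refl n≢n

update-agree : ∀ u n e → Agree (suc n) (update u n e) u
update-agree u n e k n<k with k ℕ.≟ n
... | yes refl = contradiction n<k (ℕ.n≮n n)
... | no _     = refl

-- The entries of u below n, followed by those of v from n on.
paste : ℕ → Code → Code → Code
paste n u v k with k ℕ.<? n
... | yes _ = u k
... | no _  = v k

paste-below : ∀ {n} u v {k} → k ℕ.< n → paste n u v k ≡ u k
paste-below {n} u v {k} k<n with k ℕ.<? n
... | yes _  = refl
... | no k≮n = contradiction k<n k≮n

paste-agree : ∀ n u v → Agree n (paste n u v) v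
paste-agree n u v k n≤k with k ℕ.<? n
... | yes k<n = contradiction k<n (ℕ.≤⇒≯ n≤k)
... | no _    = refl

-- Entries of sequences

⁻-at : ∀ {n} (s : 𝒮< (suc n)) i → toℕ (at (s ⁻) i) ≡ toℕ (at s (inject₁ i))
⁻-at s i = Fin.toℕ-fromℕ< _

append-at : ∀ {n} (t : 𝒮< n) a (a≤n : a ℕ.≤ n) i →
            toℕ (at (append t a a≤n) (inject₁ i)) ≡ toℕ (at t i)
append-at t a a≤n i rewrite view-inject₁ i = Fin.toℕ-fromℕ< _

last-append : ∀ {n} (t : 𝒮< n) a (a≤n : a ℕ.≤ n) → last (append t a a≤n) ≡ a
last-append {n} t a a≤n rewrite view-fromℕ n = Fin.toℕ-fromℕ< _

-- Coherent codes

module Coherence (f : ℕ → ℕ) where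

  -- The recursion of 𝒜, read off one entry: in a (k+1)-component with last
  -- entry t′, the k-component at position y has last entry t.  If t′ is
  -- k + 1, the positions are the integers and all k-components have last
  -- entry f k; otherwise they are the natural numbers, and the k-component at
  -- position 0 has last entry t′ instead.
  data Step (k t′ : ℕ) (y : ℤ) (t : ℕ) : Set where
    integer : t′ ≡ suc k → t ≡ f k → Step k t′ y t
    first   : t′ ≢ suc k → y ≡ 0ℤ → t ≡ t′ → Step k t′ y t
    later   : t′ ≢ suc k → 0ℤ ℤ.< y → t ≡ f k → Step k t′ y t

  step-functional : ∀ {k t′ y t₁ t₂} → Step k t′ y t₁ → Step k t′ y t₂ → t₁ ≡ t₂
  step-functional (integer _ p)   (integer _ q)   = trans p (sym q)
  step-functional (integer p _)   (first ¬p _ _)  = contradiction p ¬p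
  step-functional (integer p _)   (later ¬p _ _)  = contradiction p ¬p
  step-functional (first ¬p _ _)  (integer p _)   = contradiction p ¬p
  step-functional (first _ _ p)   (first _ _ q)   = trans p (sym q)
  step-functional (first _ y≡0 _) (later _ 0<y _) = contradiction 0<y (ℤ.<-irrefl (sym y≡0))
  step-functional (later ¬p _ _)  (integer p _)   = contradiction p ¬p
  step-functional (later _ 0<y _) (first _ y≡0 _) = contradiction 0<y (ℤ.<-irrefl (sym y≡0))
  step-functional (later _ _ p)   (later _ _ q)   = trans p (sym q)

  -- Above any position there are only components of last entry f k.  This is
  -- what makes the final segments above two points isomorphic.
  step-raise : ∀ {k t′ y z t} → Step k t′ y t → y ℤ.< z → Step k t′ z (f k)
  step-raise (integer t′≡1+k _)      y<z = integer t′≡1+k refl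
  step-raise (first t′≢1+k refl _)   y<z = later t′≢1+k y<z refl
  step-raise (later t′≢1+k 0<y _)    y<z = later t′≢1+k (ℤ.<-trans 0<y y<z) refl

  StepAt : Code → ℕ → Set
  StepAt u k = Step k (state (u (suc k))) (digit (u k)) (state (u k))

  -- Coherent n u concerns the entries of u below n, given the state of the
  -- n-th one.
  Coherent : ℕ → Code → Set
  Coherent n u = ∀ k → k ℕ.< n → StepAt u k

  stepAt-resp : ∀ {u v k} → u k ≡ v k → state (u (suc k)) ≡ state (v (suc k)) →
                StepAt v k → StepAt u k
  stepAt-resp {k = k} uₖ≡vₖ eq step rewrite uₖ≡vₖ | eq = step

  coherent-suc : ∀ {n u} → Coherent n u → StepAt u n → Coherent (suc n) u
  coherent-suc below step k k<1+n with ℕ.m<1+n⇒m<n∨m≡n k<1+n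
  ... | inj₁ k<n  = below k k<n
  ... | inj₂ refl = step

  entry-≡ : ∀ {u v n} → StepAt u n → StepAt v n → Agree (suc n) u v →
            digit (u n) ≡ digit (v n) → u n ≡ v n
  entry-≡ {u} {v} {n} stepᵘ stepᵛ u~v eq = cong₂ _,_
    (step-functional stepᵘ (subst₂ (λ e y → Step n (state e) y _)
      (sym (u~v (suc n) ℕ.≤-refl)) (sym eq) stepᵛ))
    eq

  -- The topmost entry at which two coherent codes differ shows it in its
  -- digit, because the states above determine the state there.
  ≼-total : ∀ n {u v} → Coherent n u → Coherent n v → Agree n u v → u ≼ v ⊎ v ≼ u
  ≼-total zero    _ _ u~v = inj₁ (inj₁ u~v)
  ≼-total (suc n) {u} {v} cᵘ cᵛ u~v with ℤ.<-cmp (digit (u n)) (digit (v n))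
  ... | tri< uₙ<vₙ _ _ = inj₁ (inj₂ (n , uₙ<vₙ , u~v))
  ... | tri> _ _ vₙ<uₙ = inj₂ (inj₂ (n , vₙ<uₙ , agree-sym u~v))
  ... | tri≈ _ uₙ≡vₙ _ = ≼-total n
    (λ k k<n → cᵘ k (ℕ.m<n⇒m<1+n k<n)) (λ k k<n → cᵛ k (ℕ.m<n⇒m<1+n k<n))
    (agree-extend (entry-≡ {u} {v} (cᵘ n ℕ.≤-refl) (cᵛ n ℕ.≤-refl) u~v uₙ≡vₙ) u~v)

  -- u is obtained from the coherent code v by changing entries up to the
  -- n-th only.
  coherent-splice : ∀ {u v} n → (∀ k → StepAt v k) →
                    Coherent n u → StepAt u n → Agree (suc n) u v →
                    ∀ k → StepAt u k
  coherent-splice {u} {v} n coherentᵛ below step u~v k with ℕ.<-cmp k n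
  ... | tri< k<n _ _  = below k k<n
  ... | tri≈ _ refl _ = step
  ... | tri> _ _ n<k  = stepAt-resp {u} {v} (u~v k n<k)
    (cong state (u~v (suc k) (ℕ.m<n⇒m<1+n n<k))) (coherentᵛ k)

  -- The state below a component of last entry t′ at position 0.
  state₀ : ℕ → ℕ → ℕ
  state₀ k t′ with t′ ℕ.≟ suc k
  ... | yes _ = f k
  ... | no _  = t′

  step₀ : ∀ k t′ → Step k t′ 0ℤ (state₀ k t′)
  step₀ k t′ with t′ ℕ.≟ suc k
  ... | yes p = integer p refl
  ... | no ¬p = first ¬p refl refl

  -- v with its entries below n replaced by digits 0 and the states that
  -- these force.
  fill : ℕ → Code → Code
  fill zero    v = v
  fill (suc n) v = fill n (update v n (state₀ n (state (v (suc n))) , 0ℤ))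

  fill-agree : ∀ n v → Agree n (fill n v) v
  fill-agree zero    v = agree-refl
  fill-agree (suc n) v = agree-trans
    (agree-weaken (ℕ.n≤1+n n) (fill-agree n _)) (update-agree v n _)

  fill-coherent : ∀ n v → Coherent n (fill n v)
  fill-coherent (suc n) v = coherent-suc {n} {fill n v′} (fill-coherent n v′)
    (stepAt-resp {fill n v′} {v′} (fill-agree n v′ n ℕ.≤-refl)
      (cong state (fill-agree n v′ (suc n) (ℕ.n≤1+n n))) step)
    where
    v′ = update v n (state₀ n (state (v (suc n))) , 0ℤ)
    step : StepAt v′ n
    step rewrite update-at v n (state₀ n (state (v (suc n))) , 0ℤ)
               | update-agree v n (state₀ n (state (v (suc n))) , 0ℤ) (suc n) ℕ.≤-refl
               = step₀ n (state (v (suc n)))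

  -- Coding the chains 𝒜 n s

  -- An isomorphism of K with the chain of codes that agree with v from n on
  -- and are coherent below n.
  record Coding (n : ℕ) (v : Code) (K : Chain) : Set where
    open TotalOrder K using (_≤_)
    field
      encode            : ∣ K ∣ → Code
      encode-agree      : ∀ c → Agree n (encode c) v
      encode-coherent   : ∀ c → Coherent n (encode c)
      encode-mono       : ∀ {c d} → c ≤ d → encode c ≼ encode d
      encode-cancel     : ∀ {c d} → encode c ≼ encode d → c ≤ d
      encode-surjective : ∀ {u} → Agree n u v → Coherent n u →
                          ∃ λ c → Agree 0 (encode c) u

  -- A coding of the n-components with n-th entry e, inside an
  -- (n+1)-component whose codes agree with v from n + 1 on.
  module Part {n v e K} (C : Coding n (update v n e) K) where
    open Coding C public

    encode-entry : ∀ c → encode c n ≡ e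
    encode-entry c = trans (encode-agree c n ℕ.≤-refl) (update-at v n e)

    encode-agree-suc : ∀ c → Agree (suc n) (encode c) v
    encode-agree-suc c = agree-trans
      (agree-weaken (ℕ.n≤1+n n) (encode-agree c)) (update-agree v n e)

    encode-coherent-suc : Step n (state (v (suc n))) (digit e) (state e) →
                          ∀ c → Coherent (suc n) (encode c)
    encode-coherent-suc step c =
      coherent-suc {n} {encode c} (encode-coherent c) stepAt
      where
      stepAt : StepAt (encode c) n
      stepAt rewrite encode-entry c | encode-agree-suc c (suc n) ℕ.≤-refl = step

    encode-surjective-suc : ∀ {u} → u n ≡ e → Agree (suc n) u v →
                            Coherent (suc n) u → ∃ λ c → Agree 0 (encode c) u
    encode-surjective-suc {u} uₙ≡e u~v coherent = encode-surjective
      (agree-extend (trans uₙ≡e (sym (update-at v n e)))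
                    (agree-trans u~v (agree-sym (update-agree v n e))))
      (λ k k<n → coherent k (ℕ.m<n⇒m<1+n k<n))

  module _ {n v e₁ e₂ K₁ K₂}
           (C₁ : Coding n (update v n e₁) K₁) (C₂ : Coding n (update v n e₂) K₂)
           where
    private
      module C₁ = Part C₁
      module C₂ = Part C₂

    parts-agree : ∀ c₁ c₂ → Agree (suc n) (C₁.encode c₁) (C₂.encode c₂)
    parts-agree c₁ c₂ =
      agree-trans (C₁.encode-agree-suc c₁) (agree-sym (C₂.encode-agree-suc c₂))

    parts-mono : digit e₁ ℤ.< digit e₂ → ∀ c₁ c₂ → C₁.encode c₁ ≼ C₂.encode c₂
    parts-mono e₁<e₂ c₁ c₂ = inj₂ (n ,
      subst₂ (λ d₁ d₂ → digit d₁ ℤ.< digit d₂)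
             (sym (C₁.encode-entry c₁)) (sym (C₂.encode-entry c₂)) e₁<e₂ ,
      parts-agree c₁ c₂)

    parts-cancel : ∀ c₁ c₂ → C₁.encode c₁ ≼ C₂.encode c₂ → digit e₁ ℤ.≤ digit e₂
    parts-cancel c₁ c₂ c₁≼c₂ = subst₂ (λ d₁ d₂ → digit d₁ ℤ.≤ digit d₂)
      (C₁.encode-entry c₁) (C₂.encode-entry c₂)
      (≼⇒digit-≤ c₁≼c₂ (parts-agree c₁ c₂))

  coding-𝟏 : ∀ v → Coding 0 v 𝟏
  coding-𝟏 v = record
    { encode = λ _ → v
    ; encode-agree = λ _ → agree-refl
    ; encode-coherent = λ _ _ ()
    ; encode-mono = λ _ → inj₁ agree-refl
    ; encode-cancel = λ _ → refl
    ; encode-surjective = λ u~v _ → tt , agree-sym u~v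
    }

  -- The digit at n is the index in ℤ.
  coding-⊗ℤ : ∀ {n v K} → state (v (suc n)) ≡ suc n →
              (∀ y → Coding n (update v n (f n , y)) K) →
              Coding (suc n) v (K ⊗ ℤ.≤-decTotalOrder)
  coding-⊗ℤ {n} {v} {K} vₙ₊₁≡1+n C = record
    { encode = λ (y , c) → Part.encode (C y) c
    ; encode-agree = λ (y , c) → Part.encode-agree-suc (C y) c
    ; encode-coherent = λ (y , c) →
        Part.encode-coherent-suc (C y) (integer vₙ₊₁≡1+n refl) c
    ; encode-mono = mono
    ; encode-cancel = cancel
    ; encode-surjective = surjective
    }
    where
    open TotalOrder (K ⊗ ℤ.≤-decTotalOrder) using (_≤_)
    encode : ∣ K ⊗ ℤ.≤-decTotalOrder ∣ → Code
    encode (y , c) = Part.encode (C y) c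

    mono : ∀ {c d} → c ≤ d → encode c ≼ encode d
    mono {y , c} {z , d} (inj₁ (y≤z , y≢z)) =
      parts-mono (C y) (C z) (ℤ.≤∧≢⇒< y≤z y≢z) c d
    mono {y , c} {_ , d} (inj₂ (refl , c≤d)) = Part.encode-mono (C y) c≤d

    cancel : ∀ {c d} → encode c ≼ encode d → c ≤ d
    cancel {y , c} {z , d} c≼d with y ℤ.≟ z
    ... | yes refl = inj₂ (refl , Part.encode-cancel (C y) c≼d)
    ... | no y≢z   = inj₁ (parts-cancel (C y) (C z) c d c≼d , y≢z)

    surjective : ∀ {u} → Agree (suc n) u v → Coherent (suc n) u →
                 ∃ λ c → Agree 0 (encode c) u
    surjective {u} u~v coherent =
      let c , c~u = Part.encode-surjective-suc (C (digit (u n)))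
            (cong (_, digit (u n)) uₙ≡fn) u~v coherent
      in (digit (u n) , c) , c~u
      where
      uₙ≡fn : state (u n) ≡ f n
      uₙ≡fn = step-functional (coherent n ℕ.≤-refl)
        (integer (trans (cong state (u~v (suc n) ℕ.≤-refl)) vₙ₊₁≡1+n) refl)

  -- The digit at n is 0 in the first summand, and m + 1 in the copy of K with
  -- index m.
  coding-⊕⊗ℕ : ∀ {n v K₀ K} → state (v (suc n)) ≢ suc n →
               Coding n (update v n (state (v (suc n)) , 0ℤ)) K₀ →
               (∀ m → Coding n (update v n (f n , + suc m)) K) →
               Coding (suc n) v (K₀ ⊕ K ⊗ ℕ.≤-decTotalOrder)
  coding-⊕⊗ℕ {n} {v} {K₀} {K} vₙ₊₁≢1+n C₀ C = record
    { encode = encode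
    ; encode-agree = λ where
        (inj₁ c)       → Part.encode-agree-suc C₀ c
        (inj₂ (m , c)) → Part.encode-agree-suc (C m) c
    ; encode-coherent = λ where
        (inj₁ c)       → Part.encode-coherent-suc C₀ (first vₙ₊₁≢1+n refl refl) c
        (inj₂ (m , c)) →
          Part.encode-coherent-suc (C m) (later vₙ₊₁≢1+n (ℤ.+<+ ℕ.z<s) refl) c
    ; encode-mono = mono
    ; encode-cancel = λ {c} {d} → cancel c d
    ; encode-surjective = surjective
    }
    where
    open TotalOrder (K₀ ⊕ K ⊗ ℕ.≤-decTotalOrder) using (_≤_)
    encode : ∣ K₀ ⊕ K ⊗ ℕ.≤-decTotalOrder ∣ → Code
    encode (inj₁ c)       = Part.encode C₀ c
    encode (inj₂ (m , c)) = Part.encode (C m) c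

    mono : ∀ {c d} → c ≤ d → encode c ≼ encode d
    mono (₁∼₁ c≤d) = Part.encode-mono C₀ c≤d
    mono (₁∼₂ {c} {m , d}) = parts-mono C₀ (C m) (ℤ.+<+ ℕ.z<s) c d
    mono (₂∼₂ {l , c} {m , d} (inj₁ (l≤m , l≢m))) =
      parts-mono (C l) (C m) (ℤ.+<+ (ℕ.s<s (ℕ.≤∧≢⇒< l≤m l≢m))) c d
    mono (₂∼₂ {l , c} {_ , d} (inj₂ (refl , c≤d))) = Part.encode-mono (C l) c≤d

    cancel : ∀ c d → encode c ≼ encode d → c ≤ d
    cancel (inj₁ c) (inj₁ d) c≼d = ₁∼₁ (Part.encode-cancel C₀ c≼d)
    cancel (inj₁ c) (inj₂ d) c≼d = ₁∼₂
    cancel (inj₂ (l , c)) (inj₁ d) c≼d with parts-cancel (C l) C₀ c d c≼d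
    ... | ℤ.+≤+ ()
    cancel (inj₂ (l , c)) (inj₂ (m , d)) c≼d with l ℕ.≟ m
    ... | yes refl = ₂∼₂ (inj₂ (refl , Part.encode-cancel (C l) c≼d))
    ... | no l≢m   = ₂∼₂ (inj₁
      (ℕ.s≤s⁻¹ (ℤ.drop‿+≤+ (parts-cancel (C l) (C m) c d c≼d)) , l≢m))

    surjective : ∀ {u} → Agree (suc n) u v → Coherent (suc n) u →
                 ∃ λ c → Agree 0 (encode c) u
    surjective {u} u~v coherent = decode (u n) refl (coherent n ℕ.≤-refl)
      where
      uₙ₊₁≡vₙ₊₁ : state (u (suc n)) ≡ state (v (suc n))
      uₙ₊₁≡vₙ₊₁ = cong state (u~v (suc n) ℕ.≤-refl)
      decode : ∀ e → u n ≡ e → Step n (state (u (suc n))) (digit e) (state e) →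
               ∃ λ c → Agree 0 (encode c) u
      decode e uₙ≡e (integer uₙ₊₁≡1+n _) =
        contradiction (trans (sym uₙ₊₁≡vₙ₊₁) uₙ₊₁≡1+n) vₙ₊₁≢1+n
      decode (_ , _) uₙ≡e (first _ refl refl) =
        let c , c~u = Part.encode-surjective-suc C₀
              (trans uₙ≡e (cong (_, 0ℤ) uₙ₊₁≡vₙ₊₁)) u~v coherent
        in inj₁ c , c~u
      decode (_ , + suc m) uₙ≡e (later _ _ refl) =
        let c , c~u = Part.encode-surjective-suc (C m) uₙ≡e u~v coherent
        in inj₂ (m , c) , c~u
      decode (_ , + zero)    _ (later _ 0<0 _) = contradiction 0<0 (ℤ.<-irrefl refl)
      decode (_ , -[1+ _ ]) _ (later _ () _)

  ⁻≡f : ∀ {n} (s : 𝒮< (suc (suc n))) →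
        (∀ i → toℕ (at s (inject₁ i)) ≡ f (toℕ i)) →
        ∀ i → toℕ (at (s ⁻) (inject₁ i)) ≡ f (toℕ i)
  ⁻≡f s s≡f i = trans (⁻-at s (inject₁ i))
    (trans (s≡f (inject₁ i)) (cong f (Fin.toℕ-inject₁ i)))

  -- If all entries of s but the last are those of f, then the same holds for
  -- s⁻ and s⁺, so only such sequences occur in the recursion.  The last entry
  -- is the state on top: for s⁻ it is f n, for s⁺ that of s.
  coding-𝒜 : ∀ n (s : 𝒮< (suc n)) → (∀ i → toℕ (at s (inject₁ i)) ≡ f (toℕ i)) →
             ∀ v → state (v n) ≡ last s → Coding n v (𝒜 n s)
  -- The case of s⁻.
  coding⁻ : ∀ {n} (s : 𝒮< (suc (suc n))) →
            (∀ i → toℕ (at s (inject₁ i)) ≡ f (toℕ i)) →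
            ∀ {v y} → v n ≡ (f n , y) → Coding n v (𝒜 n (s ⁻))

  coding-𝒜 zero    s s≡f v v₀≡s₀ = coding-𝟏 v
  coding-𝒜 (suc n) s s≡f v vₙ₊₁≡l with last s ℕ.≟ suc n
  ... | yes l≡1+n =
    coding-⊗ℤ (trans vₙ₊₁≡l l≡1+n) λ y → coding⁻ s s≡f (update-at v n (f n , y))
  ... | no l≢1+n  =
    coding-⊕⊗ℕ (λ vₙ₊₁≡1+n → l≢1+n (trans (sym vₙ₊₁≡l) vₙ₊₁≡1+n))
      (coding-𝒜 n (plus s l<1+n) plus≡f _
        (trans (cong state (update-at v n _))
               (trans vₙ₊₁≡l (sym (last-append (s ⁻ ⁻) (last s) (ℕ.s≤s⁻¹ l<1+n))))))
      (λ m → coding⁻ s s≡f (update-at v n (f n , + suc m)))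
    where
    l<1+n = ℕ.≤∧≢⇒< (last-≤ s) l≢1+n
    plus≡f : ∀ i → toℕ (at (plus s l<1+n) (inject₁ i)) ≡ f (toℕ i)
    plus≡f i = trans (append-at (s ⁻ ⁻) (last s) (ℕ.s≤s⁻¹ l<1+n) i)
                     (trans (⁻-at (s ⁻) i) (⁻≡f s s≡f i))

  coding⁻ {n} s s≡f {v} vₙ≡ = coding-𝒜 n (s ⁻) (⁻≡f s s≡f) v
    (trans (cong state vₙ≡) (sym (trans (⁻-at s (fromℕ n))
      (trans (s≡f (fromℕ n)) (cong f (Fin.toℕ-fromℕ n))))))

-- The chain of codes that eventually agree with a given one

-- base is the code of the distinguished point.  The points of the chain are
-- the coherent codes that differ from it in finitely many entries only.
module Points (f : ℕ → ℕ) (base : Code)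
              (base-coherent : ∀ k → Coherence.StepAt f base k) where

  open Coherence f

  record Point : Set where
    field
      code     : Code
      coherent : ∀ k → StepAt code k
      level    : ℕ
      settled  : Agree level code base

  open Point

  origin : Point
  origin = record { coherent = base-coherent; level = 0; settled = agree-refl }

  eventually-agree : ∀ x y → ∃ λ n → Agree n (code x) (code y)
  eventually-agree x y = level x ℕ.⊔ level y , agree-trans
    (agree-weaken (ℕ.m≤m⊔n (level x) (level y)) (settled x))
    (agree-sym (agree-weaken (ℕ.m≤n⊔m (level x) (level y)) (settled y)))

  -- A point from a code that agrees with a point from some entry on.
  point : ∀ u → (∀ k → StepAt u k) → ∀ {n} x → Agree n u (code x) → Point
  point u coherentᵘ {n} x u~x = record
    { code = u
    ; coherent = coherentᵘ
    ; level = n ℕ.⊔ level x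
    ; settled = agree-trans (agree-weaken (ℕ.m≤m⊔n n (level x)) u~x)
                            (agree-weaken (ℕ.m≤n⊔m n (level x)) (settled x))
    }

  chain : Chain
  chain = record
    { Carrier = Point
    ; _≈_ = λ x y → Agree 0 (code x) (code y)
    ; _≤_ = λ x y → code x ≼ code y
    ; isTotalOrder = record
      { isPartialOrder = record
        { isPreorder = record
          { isEquivalence = record
            { refl = agree-refl; sym = agree-sym; trans = agree-trans }
          ; reflexive = inj₁
          ; trans = ≼-trans
          }
        ; antisym = ≼-antisym
        }
      ; total = λ x y → let n , x~y = eventually-agree x y in
          ≼-total n (λ k _ → coherent x k) (λ k _ → coherent y k) x~y
      }
    }

  open TotalOrder chain using (_≤_)

  -- Uniformity

  -- z lies above x in the same way as z′ lies above y: the last difference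
  -- is at the same entry and of the same size, and below it z and z′ agree.
  data Translate (x y z z′ : Code) : Set where
    none : Agree 0 x z → Agree 0 y z′ → Translate x y z z′
    some : ∀ k d → Agree (suc k) x z → Agree (suc k) y z′ →
           digit (z k) ≡ digit (x k) ℤ.+ d → digit (z′ k) ≡ digit (y k) ℤ.+ d →
           0ℤ ℤ.< d → state (z k) ≡ state (z′ k) →
           (∀ j → j ℕ.< k → z j ≡ z′ j) → Translate x y z z′

  translate-sym : ∀ {x y z z′} → Translate x y z z′ → Translate y x z′ z
  translate-sym (none p q) = none q p
  translate-sym (some k d p q r s 0<d t b) =
    some k d q p s r 0<d (sym t) (λ j j<k → sym (b j j<k))

  translate-≺ : ∀ {x k d z} → Agree (suc k) x z →
                digit (z k) ≡ digit (x k) ℤ.+ d → 0ℤ ℤ.< d → x ≺[ k ] z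
  translate-≺ {x} {k} x~z zₖ≡xₖ+d 0<d =
    subst (digit (x k) ℤ.<_) (sym zₖ≡xₖ+d) (0<d⇒i<i+d _ 0<d) , x~z

  -- If z ≼ w, the last difference of w and x cannot be at a lower entry than
  -- that of z and x; if both are at the same entry, the last difference of z
  -- and w is there or below it and is carried over to z′ and w′.
  translate-mono : ∀ {x y z z′ w w′} → Translate x y z z′ → Translate x y w w′ →
                   z ≼ w → z′ ≼ w′
  translate-mono (none _ y~z′) (none _ y~w′) _ =
    inj₁ (agree-trans (agree-sym y~z′) y~w′)
  translate-mono (none _ y~z′) (some k d _ y~w′ _ w′ₖ 0<d _ _) _ =
    inj₂ (k , ≺-respˡ (agree-weaken ℕ.z≤n (agree-sym y~z′)) (translate-≺ y~w′ w′ₖ 0<d))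
  translate-mono (some k d x~z _ zₖ _ 0<d _ _) (none x~w _) z≼w =
    contradiction x≺z (≺-irrefl (≼-antisym (inj₂ (k , x≺z)) z≼x) ℕ.z≤n)
    where
    x≺z = translate-≺ x~z zₖ 0<d
    z≼x = ≼-trans z≼w (inj₁ (agree-sym x~w))
  translate-mono {x} {y} {z} {z′} {w} {w′}
                 (some k d x~z y~z′ zₖ z′ₖ 0<d zₖ≡z′ₖ z≡z′)
                 (some l e x~w y~w′ wₗ w′ₗ 0<e wₗ≡w′ₗ w≡w′) z≼w with ℕ.<-cmp k l
  ... | tri< k<l _ _ = inj₂ (l ,
    ≺-respˡ (agree-weaken k<l (agree-sym y~z′)) (translate-≺ y~w′ w′ₗ 0<e))
  ... | tri> _ _ l<k = contradiction w≺z
    (≺-irrefl (≼-antisym (inj₂ (k , w≺z)) z≼w) ℕ.z≤n)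
    where
    w≺z = ≺-respˡ (agree-weaken l<k (agree-sym x~w)) (translate-≺ x~z zₖ 0<d)
  ... | tri≈ _ refl _ = transfer z≼w
    where
    z~w : Agree (suc k) z w
    z~w = agree-trans (agree-sym x~z) x~w
    z′~w′ : Agree (suc k) z′ w′
    z′~w′ = agree-trans (agree-sym y~z′) y~w′

    transfer-agree : ∀ {m} → Agree m z w → Agree m z′ w′
    transfer-agree zw j m≤j with ℕ.<-cmp j k
    ... | tri< j<k _ _  = trans (sym (z≡z′ j j<k)) (trans (zw j m≤j) (w≡w′ j j<k))
    ... | tri> _ _ k<j  = z′~w′ j k<j
    ... | tri≈ _ refl _ = cong₂ _,_
      (trans (sym zₖ≡z′ₖ) (trans (cong state (zw k m≤j)) wₗ≡w′ₗ))
      (trans z′ₖ (trans (cong (λ a → digit (y k) ℤ.+ a) d≡e) (sym w′ₗ)))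
      where
      d≡e : d ≡ e
      d≡e = +-cancelˡ (digit (x k)) d e
        (trans (sym zₖ) (trans (cong digit (zw k m≤j)) wₗ))

    transfer : z ≼ w → z′ ≼ w′
    transfer (inj₁ zw) = inj₁ (transfer-agree zw)
    transfer (inj₂ (i , z≺w@(zᵢ<wᵢ , zw))) with ℕ.<-cmp i k
    ... | tri> _ _ k<i  = contradiction z≺w (≺-irrefl z~w k<i)
    ... | tri< i<k _ _  = inj₂ (i ,
      subst₂ (λ a b → digit a ℤ.< digit b) (z≡z′ i i<k) (w≡w′ i i<k) zᵢ<wᵢ ,
      transfer-agree zw)
    ... | tri≈ _ refl _ = inj₂ (i ,
      subst₂ ℤ._<_ (sym z′ₖ) (sym w′ₗ) (ℤ.+-monoʳ-< (digit (y k)) d<e) ,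
      z′~w′)
      where
      d<e : d ℤ.< e
      d<e = +-cancelˡ-< (digit (x k)) (subst₂ ℤ._<_ zₖ wₗ zᵢ<wᵢ)

  translate : ∀ x y z → x ≤ z → ∃ λ z′ → y ≤ z′ × Translate (code x) (code y) (code z) (code z′)
  translate x y z (inj₁ x~z) = y , inj₁ agree-refl , none x~z agree-refl
  translate x y z (inj₂ (k , xₖ<zₖ , x~z)) =
    point u coherentᵘ y u~y , inj₂ (k , translate-≺ (agree-sym u~y) (cong digit uₖ≡e) 0<d) ,
    some k d x~z (agree-sym u~y)
      (sym (i+[j-i]≡j (digit (code x k)) (digit (code z k)))) (cong digit uₖ≡e) 0<d
      (trans zₖ≡fk (sym (cong state uₖ≡e)))
      (λ j j<k → sym (paste-below (code z) y′ j<k))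
    where
    d = digit (code z k) ℤ.- digit (code x k)
    e = f k , digit (code y k) ℤ.+ d
    y′ = update (code y) k e
    u = paste k (code z) y′
    0<d : 0ℤ ℤ.< d
    0<d = i<j⇒0<j-i xₖ<zₖ

    uₖ≡e : u k ≡ e
    uₖ≡e = trans (paste-agree k (code z) y′ k ℕ.≤-refl) (update-at (code y) k e)
    u~y : Agree (suc k) u (code y)
    u~y = agree-trans (agree-weaken (ℕ.n≤1+n k) (paste-agree k (code z) y′))
                      (update-agree (code y) k e)

    zₖ≡fk : state (code z k) ≡ f k
    zₖ≡fk = step-functional (coherent z k)
      (subst (λ a → Step k (state a) _ (f k)) (x~z (suc k) ℕ.≤-refl)
             (step-raise (coherent x k) xₖ<zₖ))

    states : ∀ j → j ℕ.≤ k → state (u j) ≡ state (code z j)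
    states j j≤k with ℕ.m≤n⇒m<n∨m≡n j≤k
    ... | inj₁ j<k  = cong state (paste-below (code z) y′ j<k)
    ... | inj₂ refl = trans (cong state uₖ≡e) (sym zₖ≡fk)

    stepₖ : StepAt u k
    stepₖ rewrite uₖ≡e | u~y (suc k) ℕ.≤-refl =
      step-raise (coherent y k) (0<d⇒i<i+d _ 0<d)

    coherentᵘ : ∀ j → StepAt u j
    coherentᵘ = coherent-splice {u} {code y} k (coherent y)
      (λ j j<k → stepAt-resp {u} {code z} (paste-below (code z) y′ j<k)
                             (states (suc j) j<k) (coherent z j))
      stepₖ u~y

  uniform : Uniform chain
  uniform x y = correspondence⇒≅ (subchain chain (x ≤_)) (subchain chain (y ≤_))
    (λ (z , _) (z′ , _) → Translate (code x) (code y) (code z) (code z′))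
    (λ (z , x≤z) → let z′ , y≤z′ , t = translate x y z x≤z in (z′ , y≤z′) , t)
    (λ (z′ , y≤z′) → let z , x≤z , t = translate y x z′ y≤z′
                     in (z , x≤z) , translate-sym t)
    translate-mono
    (λ t t′ → translate-mono (translate-sym t) (translate-sym t′))

  -- Components and rank

  -- A point of the n-component that immediately follows that of x in its
  -- (n+1)-component.
  module _ (n : ℕ) (x : Point) where
    private
      e = f n , digit (code x n) ℤ.+ 1ℤ
      v = update (code x) n e
      u = fill n v

      uₙ≡e : u n ≡ e
      uₙ≡e = trans (fill-agree n v n ℕ.≤-refl) (update-at (code x) n e)

      u~x : Agree (suc n) u (code x)
      u~x = agree-trans (agree-weaken (ℕ.n≤1+n n) (fill-agree n v))
                        (update-agree (code x) n e)

      0<1 : 0ℤ ℤ.< 1ℤ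
      0<1 = ℤ.+<+ ℕ.z<s

      stepₙ : StepAt u n
      stepₙ rewrite uₙ≡e | u~x (suc n) ℕ.≤-refl =
        step-raise (coherent x n) (0<d⇒i<i+d _ 0<1)

    next : Point
    next = point u
      (coherent-splice {u} {code x} n (coherent x) (fill-coherent n v) stepₙ u~x) x u~x

    next-digit : digit (code next n) ≡ digit (code x n) ℤ.+ 1ℤ
    next-digit = cong digit uₙ≡e

    next-agree : Agree (suc n) (code x) (code next)
    next-agree = agree-sym u~x

    ≺-next : code x ≺[ n ] code next
    ≺-next = translate-≺ next-agree next-digit 0<1

  -- By determinism of the states, the digit alone tells the n-components of an
  -- (n+1)-component apart.
  iterate-next : ∀ n m x y → Agree (suc n) (code x) (code y) →
                 digit (code x n) ℤ.+ + m ≡ digit (code y n) →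
                 Agree n (code (iterate (next n) x m)) (code y)
  iterate-next n zero x y x~y xₙ+0≡yₙ = agree-extend
    (entry-≡ {code x} {code y} (coherent x n) (coherent y n) x~y
      (trans (sym (ℤ.+-identityʳ _)) xₙ+0≡yₙ))
    x~y
  iterate-next n (suc m) x y x~y xₙ+1+m≡yₙ = iterate-next n m (next n x) y
    (agree-trans (agree-sym (next-agree n x)) x~y)
    (trans (cong (λ a → a ℤ.+ + m) (next-digit n x))
           (trans (ℤ.+-assoc (digit (code x n)) 1ℤ (+ m)) xₙ+1+m≡yₙ))

  next-reaches : ∀ n {x y} → x ≤ y → Agree (suc n) (code x) (code y) →
                 ∃ λ m → Agree n (code (iterate (next n) x m)) (code y)
  next-reaches n {x} {y} x≤y x~y =
    let m , xₙ+m≡yₙ = i≤j⇒i+n≡j (≼⇒digit-≤ x≤y x~y)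
    in m , iterate-next n m x y x~y xₙ+m≡yₙ

  agreement : ℕ → ConvexEquivalence chain
  agreement n = record
    { _∼_ = λ x y → Agree n (code x) (code y)
    ; isEquivalence = record
      { refl = agree-refl; sym = agree-sym; trans = agree-trans }
    ; reflexive = agree-weaken ℕ.z≤n
    ; convex = agree-convex
    }

  ρ⇔agree : ∀ n x y → ρ<._∼_ chain n x y ⇔ Agree n (code x) (code y)
  ρ⇔agree zero    x y = mk⇔ id id
  ρ⇔agree (suc n) x y = FiniteIntervals.finite⇔∼ (chain / ρ< chain n)
    (coarsen (ρ< chain n) (agreement (suc n))
      (λ {x} {y} xρy → agree-weaken (ℕ.n≤1+n n) (to x y xρy)))
    (next n)
    (λ x → inj₁ (inj₂ (n , ≺-next n x)))
    (λ x xρnext → ≺-irrefl (to x (next n x) xρnext) ℕ.≤-refl (≺-next n x))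
    (next-agree n)
    (λ {x} {y} → reach {x} {y})
    x y
    where
    to : ∀ x y → ρ<._∼_ chain n x y → Agree n (code x) (code y)
    to x y = Equivalence.to (ρ⇔agree n x y)
    from : ∀ x y → Agree n (code x) (code y) → ρ<._∼_ chain n x y
    from x y = Equivalence.from (ρ⇔agree n x y)
    reach : ∀ {x y} → x ≤ y ⊎ ρ<._∼_ chain n x y → Agree (suc n) (code x) (code y) →
            ∃ λ m → ρ<._∼_ chain n (iterate (next n) x m) y
    reach {x} {y} (inj₁ x≤y) x~y =
      let m , xₘ~y = next-reaches n {x} {y} x≤y x~y
      in m , from (iterate (next n) x m) y xₘ~y
    reach (inj₂ xρy) _ = 0 , xρy

  isRank-ω : IsRank chain ⊤⁺
  isRank-ω = trivial , nontrivial
    where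
    related : ∀ x y → ∃ λ n → ρ<._∼_ chain n x y
    related x y = let n , x~y = eventually-agree x y
                  in n , Equivalence.from (ρ⇔agree n x y) x~y

    trivial : chain / ρ chain ⊤⁺ ≅ 𝟏
    trivial = correspondence⇒≅ (chain / ρ chain ⊤⁺) 𝟏 (λ _ _ → ⊤)
      (λ _ → tt , tt) (λ _ → origin , tt) (λ _ _ _ → refl)
      (λ {x} {_} {y} _ _ _ → inj₂ (related x y))

    nontrivial : ∀ β → β <⁺ ⊤⁺ → ¬ (chain / ρ chain β ≅ 𝟏)
    nontrivial [ n ] [ n ]<⊤⁺ (_ , iso) = ≺-irrefl
      (Equivalence.to (ρ⇔agree n origin (next n origin))
        (IsOrderIsomorphism.injective iso refl))
      ℕ.≤-refl (≺-next n origin)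

  -- The codes agreeing with base from n on and coherent below n are coherent
  -- everywhere, and are the codes of the points of the n-component of origin.
  component-≅ : ∀ {n K} → Coding n base K → component chain [ n ] origin ≅ K
  component-≅ {n} {K} C = correspondence⇒≅ (component chain [ n ] origin) K
    (λ (x , _) c → Agree 0 (encode c) (code x))
    (λ (x , ρx) → encode-surjective
      (agree-sym (Equivalence.to (ρ⇔agree n origin x) ρx)) (λ k _ → coherent x k))
    (λ c → (member c , Equivalence.from (ρ⇔agree n origin (member c))
                                        (agree-sym (encode-agree c))) , agree-refl)
    (λ c~x d~y x≼y → encode-cancel
      (≼-trans (inj₁ c~x) (≼-trans x≼y (inj₁ (agree-sym d~y)))))
    (λ c~x d~y c≤d →
      ≼-trans (inj₁ (agree-sym c~x)) (≼-trans (encode-mono c≤d) (inj₁ d~y)))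
    where
    open Coding C
    member-coherent : ∀ c k → StepAt (encode c) k
    member-coherent c k with k ℕ.<? n
    ... | yes k<n = encode-coherent c k k<n
    ... | no k≮n  = stepAt-resp {encode c} {base} (encode-agree c k n≤k)
      (cong state (encode-agree c (suc k) (ℕ.m≤n⇒m≤1+n n≤k))) (base-coherent k)
      where n≤k = ℕ.≮⇒≥ k≮n
    member : ∣ K ∣ → Point
    member c = point (encode c) (member-coherent c) origin (encode-agree c)

-- Derived sequences

nextPositive-unique : ∀ {π n a b} → NextPositive π n a → NextPositive π n b → a ≡ b
nextPositive-unique (least n≤u 0<πu u≤) (least n≤v 0<πv v≤) =
  cong [_] (ℕ.≤-antisym (u≤ n≤v 0<πv) (v≤ n≤u 0<πu))
nextPositive-unique (least n≤u 0<πu _) (none ≯0) = contradiction 0<πu (≯0 n≤u)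
nextPositive-unique (none ≯0) (least n≤v 0<πv _) = contradiction 0<πv (≯0 n≤v)
nextPositive-unique (none _) (none _) = refl

0<⁺⇒≢0 : ∀ {a} → [ 0 ] <⁺ a → a ≢ [ 0 ]
0<⁺⇒≢0 [ () ] refl

≢0⇒0<⁺ : ∀ {a} → a ≢ [ 0 ] → [ 0 ] <⁺ a
≢0⇒0<⁺ {[ zero ]}  a≢0 = contradiction refl a≢0
≢0⇒0<⁺ {[ suc _ ]} _   = [ ℕ.z<s ]
≢0⇒0<⁺ {⊤⁺}        _   = [ 0 ]<⊤⁺

nextPositive-suc : ∀ {π n a} → π n ≡ [ 0 ] → NextPositive π n a → NextPositive π (suc n) a
nextPositive-suc πn≡0 (least n≤v 0<πv v≤) = least
  (ℕ.≤∧≢⇒< n≤v λ { refl → 0<⁺⇒≢0 0<πv πn≡0 }) 0<πv (λ n<u → v≤ (ℕ.<⇒≤ n<u))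
nextPositive-suc πn≡0 (none ≯0) = none (λ n<v → ≯0 (ℕ.<⇒≤ n<v))

finiteValue-≡ : ∀ {a n} (a≤n : a ≤⁺ [ n ]) → [ finiteValue a≤n ] ≡ a
finiteValue-≡ [ _ ] = refl

-- The values of σ below ω as natural numbers.
finitePart : 𝒮ω+1 → ℕ → ℕ
finitePart σ k = finiteValue (at-≤ σ [ k ])

↾-at : ∀ σ k i → toℕ (at (σ ↾ k) i) ≡ finitePart σ (toℕ i)
↾-at σ k i = Fin.toℕ-fromℕ< _

module Derived (σ : 𝒮ω+1) (π w : ℕ → ω+1)
               (next : ∀ n → NextPositive π n (w n)) (c : Compatible σ π w) where

  private
    f = finitePart σ
    s = derived σ π w c

  derived-at : ∀ n i → toℕ (at (s n) (inject₁ i)) ≡ f (toℕ i)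
  derived-at n i with π n ≟⁺ [ 0 ]
  ... | yes p = trans (append-at (σ ↾ n) _ (finiteValue-≤ (Compatible.next-≤ c n p)) i)
                      (↾-at σ n i)
  ... | no _  = trans (↾-at σ (suc n) (inject₁ i)) (cong f (Fin.toℕ-inject₁ i))

  last-derived-0 : ∀ n → π n ≡ [ 0 ] → [ last (s n) ] ≡ at σ (w n)
  last-derived-0 n πn≡0 with π n ≟⁺ [ 0 ]
  ... | yes p = trans (cong [_] (last-append (σ ↾ n) _ (finiteValue-≤ σw≤n)))
                      (finiteValue-≡ σw≤n)
    where σw≤n = Compatible.next-≤ c n p
  ... | no ¬p = contradiction πn≡0 ¬p

  last-derived-≢0 : ∀ n → π n ≢ [ 0 ] → last (s n) ≡ f n
  last-derived-≢0 n πn≢0 with π n ≟⁺ [ 0 ]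
  ... | yes p = contradiction p πn≢0
  ... | no _  = trans (↾-at σ (suc n) (fromℕ n)) (cong f (Fin.toℕ-fromℕ n))

  -- If π vanishes at n and n + 1 then w_n = w_(n+1); if it vanishes at n only
  -- then w_n = n + 1.
  last-derived-suc : ∀ n → π n ≡ [ 0 ] → last (s n) ≡ last (s (suc n))
  last-derived-suc n πn≡0 = []-injective (trans (last-derived-0 n πn≡0)
    (σw≡ (π (suc n) ≟⁺ [ 0 ])))
    where
    w′ : NextPositive π (suc n) (w n)
    w′ = nextPositive-suc πn≡0 (next n)
    σw≡ : Dec (π (suc n) ≡ [ 0 ]) → at σ (w n) ≡ [ last (s (suc n)) ]
    σw≡ (yes π≡0) = trans (cong (at σ) (nextPositive-unique w′ (next (suc n))))
                            (sym (last-derived-0 (suc n) π≡0))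
    σw≡ (no π≢0)  = trans
      (cong (at σ) (nextPositive-unique w′
        (least ℕ.≤-refl (≢0⇒0<⁺ π≢0) (λ 1+n≤u _ → 1+n≤u))))
      (trans (sym (finiteValue-≡ (at-≤ σ [ suc n ])))
             (cong [_] (sym (last-derived-≢0 (suc n) π≢0))))

  open Coherence f

  -- Only whether the n-component is the first one of its (n+1)-component
  -- matters; a component that is not is put at position 1 in ℕ, or 0 in ℤ.
  derived-step : ∀ n → ∃ λ y → Step n (last (s (suc n))) y (last (s n))
  derived-step n = step (π n ≟⁺ [ 0 ]) (last (s (suc n)) ℕ.≟ suc n)
    where
    step : Dec (π n ≡ [ 0 ]) → Dec (last (s (suc n)) ≡ suc n) →
           ∃ λ y → Step n (last (s (suc n))) y (last (s n))
    step (yes πn≡0) _ = 0ℤ , first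
      (λ l≡1+n → ℕ.n≮n n (subst (ℕ._≤ n)
        (trans (last-derived-suc n πn≡0) l≡1+n) (last-≤ (s n))))
      refl (last-derived-suc n πn≡0)
    step (no πn≢0) (yes l≡1+n) = 0ℤ , integer l≡1+n (last-derived-≢0 n πn≢0)
    step (no πn≢0) (no l≢1+n)  =
      1ℤ , later l≢1+n (ℤ.+<+ ℕ.z<s) (last-derived-≢0 n πn≢0)

  base : Code
  base n = last (s n) , proj₁ (derived-step n)

  base-coherent : ∀ n → StepAt base n
  base-coherent n = proj₂ (derived-step n)

mainTheorem7 : (σ : 𝒮ω+1) (π w : ℕ → ω+1) →
    (∀ n → NextPositive π n (w n)) →
    (c : Compatible σ π w) →
    Σ Chain λ A → Uniform A × IsRank A ⊤⁺ ×
    Σ ∣ A ∣ λ x → ∀ n → component A [ n ] x ≅ 𝒜 n (derived σ π w c n)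
mainTheorem7 σ π w next c =
  chain , uniform , isRank-ω , origin ,
  λ n → component-≅ (coding-𝒜 n (derived σ π w c n) (derived-at n) base refl)
  where
  open Derived σ π w next c
  open Coherence (finitePart σ)
  open Points (finitePart σ) base base-coherent hiding (next)
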